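{- Let $S$ be an Artinian bounded semilattice with more than two elements. Then $G(S)$ is a complete graph if and only if $|\mathrm{Atom}(S)|=1$.
   Context: A bounded semilattice $(S,\cdot,0,1)$ is a commutative semigroup whose operation is idempotent ($x\cdot x=x$ for all $x$), with a neutral element $1$ and an absorbing element $0$; it is partially ordered by $x\le y \iff x\cdot y=x$, so that $0\le x\le 1$. The graph $G(S)$ is the simple graph with vertex set $S\setminus\{0,1\}$ in which two vertices $x,y$ are adjacent iff $x\ne y$ and $x\cdot y\neq 0$. An atom of $S$ is an element $a$ with $0<a<1$ such that $0\le y\le a$ implies $y=0$ or $y=a$; $\mathrm{Atom}(S)$ is the set of atoms. $S$ is Artinian if every decreasing chain $s_1\ge s_2\ge\cdots$ in $S$ is stationary, i.e. there is $n$ with $s_i=s_{i+1}$ for all $i\ge n$. -}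

module Defs where

open import Level using (Level; _⊔_) renaming (suc to lsuc)
open import Algebra.Core using (Op₂)
import Algebra.Definitions as AlgebraDefinitions
open import Algebra.Lattice.Structures using (IsBoundedSemilattice)
open import Data.Fin.Base using (Fin)
open import Data.Nat.Base as ℕ using (ℕ)
open import Data.Product.Base using (Σ; ∃; _×_; _,_; proj₁; proj₂)
open import Data.Sum.Base using (_⊎_)
open import Function.Base using (_∘_)
open import Function.Bundles using (Injection; Inverse)
open import Relation.Binary.Bundles using (Setoid)
import Relation.Binary.Construct.NaturalOrder.Left as LeftNaturalOrder
import Relation.Binary.Construct.NonStrictToStrict as ToStrict
import Relation.Binary.Construct.On as On
open import Relation.Binary.Core using (Rel)
open import Relation.Binary.Definitions using (Symmetric; Irreflexive; _Respects₂_)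
import Relation.Binary.PropositionalEquality.Properties as ≡
open import Relation.Nullary.Negation using (¬_)
open import Relation.Unary using (Pred)

private
  variable
    c ℓ a p : Level

-- Sets are setoids throughout, so elements are counted up to their equality.

HasCardinality : Setoid c ℓ → ℕ → Set (c ⊔ ℓ)
HasCardinality A n = Inverse A (≡.setoid (Fin n))

HasMoreThan : ℕ → Setoid c ℓ → Set (c ⊔ ℓ)
HasMoreThan n A = Injection (≡.setoid (Fin (ℕ.suc n))) A

-- The proof component is ignored by the equality.
SubSetoid : (A : Setoid c ℓ) → Pred (Setoid.Carrier A) p → Setoid (c ⊔ p) ℓ
SubSetoid A P = On.setoid {B = Σ (Setoid.Carrier A) P} A proj₁

record SimpleGraph c ℓ a : Set (lsuc (c ⊔ ℓ ⊔ a)) where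
  field
    vertices : Setoid c ℓ

  open Setoid vertices public
    using () renaming (Carrier to Vertex; _≈_ to _≈ᵥ_)

  field
    Adjacent   : Rel Vertex a
    adj-sym    : Symmetric Adjacent
    adj-irrefl : Irreflexive _≈ᵥ_ Adjacent
    adj-resp-≈ : Adjacent Respects₂ _≈ᵥ_

IsComplete : SimpleGraph c ℓ a → Set (c ⊔ ℓ ⊔ a)
IsComplete G = ∀ x y → ¬ (x ≈ᵥ y) → Adjacent x y
  where open SimpleGraph G

-- IsBoundedSemilattice only asks for an idempotent commutative monoid, so the
-- absorbing element is added here.  0# ≉ 1# is not required.
record BoundedSemilattice₀₁ c ℓ : Set (lsuc (c ⊔ ℓ)) where
  infixr 7 _∙_
  infix  4 _≈_
  field
    Carrier              : Set c
    _≈_                  : Rel Carrier ℓ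
    _∙_                  : Op₂ Carrier
    0#                   : Carrier
    1#                   : Carrier
    isBoundedSemilattice : IsBoundedSemilattice _≈_ _∙_ 1#
    zero                 : AlgebraDefinitions.Zero _≈_ 0# _∙_

  open IsBoundedSemilattice _≈_ isBoundedSemilattice public
    using (setoid; refl; sym; trans; ∙-cong; assoc; comm; idem; identity)
  open Setoid setoid public using (_≉_)

  -- x ≤ y  unfolds to  x ≈ x ∙ y.
  open LeftNaturalOrder _≈_ _∙_ public using (_≤_)

  -- x < y  unfolds to  x ≤ y × x ≉ y.
  open ToStrict _≈_ _≤_ public using (_<_)

module _ (S : BoundedSemilattice₀₁ c ℓ) where
  open BoundedSemilattice₀₁ S

  IsAtom : Pred Carrier (c ⊔ ℓ)
  IsAtom x = 0# < x × x < 1# × (∀ y → 0# ≤ y → y ≤ x → y ≈ 0# ⊎ y ≈ x)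

  Atom : Setoid (c ⊔ ℓ) ℓ
  Atom = SubSetoid setoid IsAtom

  -- Chains are indexed from 0.
  Artinian : Set (c ⊔ ℓ)
  Artinian = (s : ℕ → Carrier) → (∀ i → s (ℕ.suc i) ≤ s i) →
             ∃ λ n → ∀ i → n ℕ.≤ i → s i ≈ s (ℕ.suc i)

  G : SimpleGraph (c ⊔ ℓ) ℓ ℓ
  G = record
    { vertices   = SubSetoid setoid (λ x → x ≉ 0# × x ≉ 1#)
    ; Adjacent   = λ (x , _) (y , _) → x ≉ y × x ∙ y ≉ 0#
    ; adj-sym    = λ {(x , _)} {(y , _)} (x≉y , xy≉0) →
                     x≉y ∘ sym , xy≉0 ∘ trans (comm x y)
    ; adj-irrefl = λ x≈y (x≉y , _) → x≉y x≈y
    ; adj-resp-≈ =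
        (λ y≈z (x≉y , xy≉0) →
           (λ x≈z → x≉y (trans x≈z (sym y≈z))) ,
           (λ xz≈0 → xy≉0 (trans (∙-cong refl y≈z) xz≈0))) ,
        (λ y≈z (y≉x , yx≉0) →
           (λ z≈x → y≉x (trans y≈z z≈x)) ,
           (λ zx≈0 → yx≉0 (trans (∙-cong y≈z refl) zx≈0)))
    }

{-# OPTIONS --safe #-}

-- Descending from a nonzero element as long as possible, the Artinian condition
-- gives an atom below every vertex.  Two distinct atoms have product 0, so they
-- are never adjacent in G(S); and a single atom lies below both x and y, hence
-- below x ∙ y, for all vertices x and y.

module Submission where

open import Defs
open import Level using (Level; _⊔_; Lift; lift; lower)
open import Axiom.ExcludedMiddle using (ExcludedMiddle)
open import Data.Fin.Base using (Fin; zero; suc)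
open import Data.Fin.Properties using (<⇒≢; any?; pigeonhole; ¬∀⟶∃¬)
open import Data.Nat.Base as ℕ using (ℕ)
import Data.Nat.Properties as ℕ
open import Data.Nat.GeneralisedArithmetic using (fold)
open import Data.Product.Base using (∃; _×_; _,_; proj₁; proj₂)
open import Data.Sum.Base using (_⊎_; inj₁; inj₂)
open import Data.Vec.Functional using ([]; _∷_)
open import Function.Base using (_∘_)
open import Function.Bundles using (_⇔_; mk⇔; Injection)
open import Function.Properties.Inverse using (Inverse⇒Injection)
open import Relation.Binary.Bundles using (Poset; Setoid)
open import Relation.Binary.Definitions using (Decidable)
import Relation.Binary.Construct.NaturalOrder.Left as LeftNaturalOrder
open import Relation.Binary.PropositionalEquality.Core as ≡ using (_≡_)
open import Algebra.Lattice.Structures using (module IsBoundedSemilattice)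
open import Relation.Nullary.Decidable using (Dec; yes; no; map′; decidable-stable)
open import Relation.Nullary.Negation using (¬_; contradiction)

module _ {c ℓ} (A : Setoid c ℓ) where
  open Setoid A

  -- Pigeonhole: if each of the n + 1 distinct elements equalled some `v k`, two of them would share
  -- a `k` and so be equal. Decidability makes the failure of covering a finite search, which
  -- returns the element missed.
  hasMoreThan⇒∃≉ : Decidable _≈_ → ∀ {n} → HasMoreThan n A →
                   (v : Fin n → Carrier) → ∃ λ x → ∀ k → x ≉ v k
  hasMoreThan⇒∃≉ _≟_ {n} n<A v =
    let i , fi∉v = ¬∀⟶∃¬ _ _ (λ i → any? (λ k → to i ≟ v k)) ¬covered
    in to i , λ k fi≈vk → fi∉v (k , fi≈vk)
    where
    open Injection n<A using (to; injective)

    ¬covered : ¬ (∀ i → ∃ λ k → to i ≈ v k)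
    ¬covered cov =
      let i , j , i<j , ki≡kj = pigeonhole (ℕ.n<1+n n) (proj₁ ∘ cov)
      in <⇒≢ i<j (injective
           (trans (proj₂ (cov i))
           (trans (reflexive (≡.cong v ki≡kj)) (sym (proj₂ (cov j))))))

module _ {c ℓ} (S : BoundedSemilattice₀₁ c ℓ) where
  open BoundedSemilattice₀₁ S renaming (zero to 0#-zero)
  open IsBoundedSemilattice _≈_ isBoundedSemilattice
    using (isSemilattice; identityʳ)
  open LeftNaturalOrder _≈_ _∙_ using (poset; x∙y≤x; x∙y≤y; ∙-presʳ-≤)
  open Poset (poset isSemilattice)
    using (antisym; ≤-respʳ-≈; ≤-respˡ-≈) renaming (refl to ≤-refl; trans to ≤-trans)

  0≤x : ∀ x → 0# ≤ x
  0≤x x = sym (proj₁ 0#-zero x)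

  x≤1 : ∀ x → x ≤ 1#
  x≤1 x = sym (identityʳ x)

  x≤0⇒x≈0 : ∀ {x} → x ≤ 0# → x ≈ 0#
  x≤0⇒x≈0 {x} x≤0 = antisym x≤0 (0≤x x)

  1≤x⇒x≈1 : ∀ {x} → 1# ≤ x → x ≈ 1#
  1≤x⇒x≈1 {x} 1≤x = antisym (x≤1 x) 1≤x

  atom≉0 : ∀ {a} → IsAtom S a → a ≉ 0#
  atom≉0 ((_ , 0≉a) , _) = 0≉a ∘ sym

  atom≉1 : ∀ {a} → IsAtom S a → a ≉ 1#
  atom≉1 (_ , (_ , a≉1) , _) = a≉1

  -- The product lies below both atoms; being nonzero, it equals each of them by minimality.
  atoms-meeting-≈ : ∀ {a b} → IsAtom S a → IsAtom S b → a ∙ b ≉ 0# → a ≈ b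
  atoms-meeting-≈ {a} {b} (_ , _ , minₐ) (_ , _ , minᵇ) ab≉0
    with minₐ (a ∙ b) (0≤x _) (x∙y≤x isSemilattice a b)
       | minᵇ (a ∙ b) (0≤x _) (x∙y≤y isSemilattice a b)
  ... | inj₁ ab≈0 | _         = contradiction ab≈0 ab≉0
  ... | inj₂ _    | inj₁ ab≈0 = contradiction ab≈0 ab≉0
  ... | inj₂ ab≈a | inj₂ ab≈b = trans (sym ab≈a) ab≈b

  common-lower-bound⇒∙≉0 : ∀ {a x y} → a ≉ 0# → a ≤ x → a ≤ y → x ∙ y ≉ 0#
  common-lower-bound⇒∙≉0 {a} a≉0 a≤x a≤y xy≈0 =
    a≉0 (x≤0⇒x≈0 (≤-respʳ-≈ xy≈0 (∙-presʳ-≤ isSemilattice a a≤x a≤y)))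

  module _ (em : ExcludedMiddle (c ⊔ ℓ)) where

    _≟_ : Decidable _≈_
    -- Equality lives in level `ℓ`, so it is lifted to the level at which `em` decides.
    x ≟ y = map′ lower lift (em {Lift c (x ≈ y)})

    module _ (artinian : Artinian S) where

      atom-below : ∀ x → x ≉ 0# → x ≉ 1# → ∃ λ a → IsAtom S a × a ≤ x
      atom-below x x≉0 x≉1 = bottom , isAtom , s≤x n
        where
        Smaller : Carrier → Carrier → Set ℓ
        Smaller y z = z ≉ 0# × z < y

        -- The decision is an argument, so that the facts below follow by matching on it; the chain
        -- `s` then supplies `em`.
        descend : ∀ {y} → Dec (∃ (Smaller y)) → Carrier
        descend     (yes (z , _)) = z
        descend {y} (no _)        = y

        descend-≤ : ∀ {y} (d : Dec (∃ (Smaller y))) → descend d ≤ y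
        descend-≤ (yes (_ , _ , z≤y , _)) = z≤y
        descend-≤ (no _)                  = ≤-refl

        descend-≉0 : ∀ {y} → y ≉ 0# → (d : Dec (∃ (Smaller y))) → descend d ≉ 0#
        descend-≉0 _   (yes (_ , z≉0 , _)) = z≉0
        descend-≉0 y≉0 (no _)              = y≉0

        -- A `yes` step goes strictly down, so the chain can stand still only where no smaller
        -- nonzero element exists.
        descend-stationary : ∀ {y} (d : Dec (∃ (Smaller y))) → y ≈ descend d →
                             ¬ ∃ (Smaller y)
        descend-stationary (yes (_ , _ , _ , z≉y)) y≈z = contradiction (sym y≈z) z≉y
        descend-stationary (no ¬smaller)           _   = ¬smaller

        s : ℕ → Carrier
        s = fold x (λ y → descend {y} em)

        s≤x : ∀ i → s i ≤ x
        s≤x ℕ.zero    = ≤-refl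
        s≤x (ℕ.suc i) = ≤-trans (descend-≤ em) (s≤x i)

        s≉0 : ∀ i → s i ≉ 0#
        s≉0 ℕ.zero    = x≉0
        s≉0 (ℕ.suc i) = descend-≉0 (s≉0 i) em

        stationary : ∃ λ n → ∀ i → n ℕ.≤ i → s i ≈ s (ℕ.suc i)
        stationary = artinian s (λ i → descend-≤ em)

        n : ℕ
        n = proj₁ stationary

        bottom : Carrier
        bottom = s n

        ¬smaller : ¬ ∃ (Smaller bottom)
        ¬smaller = descend-stationary em (proj₂ stationary n ℕ.≤-refl)

        minimal : ∀ y → 0# ≤ y → y ≤ bottom → y ≈ 0# ⊎ y ≈ bottom
        minimal y _ y≤b with y ≟ 0#
        ... | yes y≈0 = inj₁ y≈0
        ... | no  y≉0 = inj₂ (decidable-stable (y ≟ bottom)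
                          (λ y≉b → ¬smaller (y , y≉0 , y≤b , y≉b)))

        isAtom : IsAtom S bottom
        isAtom = (0≤x bottom , s≉0 n ∘ sym)
               -- Since `bottom` lies below `x`, equality with the top would force `x` to be the top
               -- as well.
               , (x≤1 bottom , λ b≈1 → x≉1 (1≤x⇒x≈1 (≤-respˡ-≈ b≈1 (s≤x n))))
               , minimal

      complete⇒one-atom : HasMoreThan 2 setoid → IsComplete (G S) →
                          HasCardinality (Atom S) 1
      complete⇒one-atom 2<S complete = record
        { to        = λ _ → zero
        ; from      = λ _ → a , a-atom
        ; to-cong   = λ _ → ≡.refl
        ; from-cong = λ _ → refl
        ; inverse   = (λ { {zero} _ → ≡.refl })
                    , (λ {(b , b-atom)} _ → unique a-atom b-atom)
        }
        where
        -- Three distinct elements cannot all be `0#` or `1#`; the one left over is a vertex, and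
        -- the atom is found below it.
        vertex : ∃ λ x → ∀ k → x ≉ (0# ∷ 1# ∷ []) k
        vertex = hasMoreThan⇒∃≉ setoid _≟_ 2<S (0# ∷ 1# ∷ [])

        atom : ∃ λ a → IsAtom S a × a ≤ proj₁ vertex
        atom = atom-below _ (proj₂ vertex zero) (proj₂ vertex (suc zero))

        a      = proj₁ atom
        a-atom = proj₁ (proj₂ atom)

        unique : ∀ {a b} → IsAtom S a → IsAtom S b → a ≈ b
        -- Completeness yields adjacency only for distinct vertices, so equality is proved by
        -- refuting its negation.
        unique {a} {b} pa pb = decidable-stable (a ≟ b) λ a≉b →
          a≉b (atoms-meeting-≈ pa pb (proj₂
            (complete (a , atom≉0 pa , atom≉1 pa) (b , atom≉0 pb , atom≉1 pb) a≉b)))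

      one-atom⇒complete : HasCardinality (Atom S) 1 → IsComplete (G S)
      one-atom⇒complete |Atom|≡1 (x , x≉0 , x≉1) (y , y≉0 , y≉1) x≉y =
        let a , pa , a≤x = atom-below x x≉0 x≉1
            b , pb , b≤y = atom-below y y≉0 y≉1
        in x≉y , common-lower-bound⇒∙≉0 (atom≉0 pa) a≤x
                   -- The atom found below `y` is the one found below `x`, which makes `a` a common
                   -- lower bound.
                   (≤-respˡ-≈ (unique (b , pb) (a , pa)) b≤y)
        where
        open Injection (Inverse⇒Injection |Atom|≡1) using (to; injective)

        Fin1-≡ : (i j : Fin 1) → i ≡ j
        Fin1-≡ zero zero = ≡.refl

        unique : (a b : Setoid.Carrier (Atom S)) → proj₁ a ≈ proj₁ b
        -- The implicit arguments are given because the equality of atoms ignores their proof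
        -- components, which unification therefore cannot recover.
        unique a b = injective {a} {b} (Fin1-≡ (to a) (to b))

corollary2p15 : ∀ {c ℓ : Level} → ExcludedMiddle (c ⊔ ℓ) →
    (S : BoundedSemilattice₀₁ c ℓ) →
    Artinian S →
    HasMoreThan 2 (BoundedSemilattice₀₁.setoid S) →
    IsComplete (G S) ⇔ HasCardinality (Atom S) 1
corollary2p15 em S artinian 2<S =
  mk⇔ (complete⇒one-atom S em artinian 2<S) (one-atom⇒complete S em artinian)
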